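{- Let $r$ be a positive integer. The threshold for growing paths is $1+a(\mathrm{PSG}_r)$. That is, for each fixed integer $k$ with $0\le k\le r!$, as $n\to\infty$: $f(n,r,k)=O(1)$ if $k\le a(\mathrm{PSG}_r)$, and $f(n,r,k)=\omega(1)$ (i.e. $f(n,r,k)\to\infty$) if $k>a(\mathrm{PSG}_r)$.
   Context: An $r$-digraph $G$ consists of a finite vertex set $V(G)$ and an edge set $E(G)$ whose elements are ordered lists of $r$ distinct vertices. An $(r,k)$-tournament is an $r$-digraph $G$ such that for every $r$-element set $S\subseteq V(G)$, exactly $k$ of the $r!$ orderings of $S$ are edges of $G$. The tight path $P^{(r)}_s$ is the $r$-digraph with $s$ distinct vertices $v_1,\ldots,v_s$ whose edges are exactly the lists of $r$ consecutive vertices $(v_i,\ldots,v_{i+r-1})$, $1\le i\le s-r+1$ (no edges if $s<r$). An $r$-digraph $G$ contains $P^{(r)}_s$ if there is an injection of its vertices into $V(G)$ mapping edges to edges. $f(n,r,k)$ is the maximum integer $s$ such that every $n$-vertex $(r,k)$-tournament contains a copy of $P^{(r)}_s$. The threshold for growing paths is the minimum $k$ such that $f(n,r,k)\to\infty$ as $n\to\infty$. Two lists $(a_1,\ldots,a_s)$ and $(b_1,\ldots,b_s)$, each with distinct entries, pattern-match if for all $i<j$ we have $a_i<a_j$ if and only if $b_i<b_j$. The pattern-shift graph $\mathrm{PSG}_r$ is the digraph (loops allowed) whose vertices are the permutations of $[r]=\{1,\ldots,r\}$ written as lists, with an edge from $a$ to $b$ (possibly $a=b$) if and only if the list of the last $r-1$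 entries of $a$ and the list of the first $r-1$ entries of $b$ pattern-match. For a digraph $G$, $a(G)$ is the maximum size of a set of vertices inducing an acyclic subgraph, i.e. one with no directed cycle (loops count as cycles of length 1, and directed 2-cycles count as cycles). -}

module Defs where

open import Data.Bool.Base using (if_then_else_)
open import Data.Fin.Base as Fin using (Fin; toℕ)
import Data.Fin.Properties as Fin
open import Data.Fin.Subset using (Subset; ⊤; _∈_; ∣_∣)
open import Data.Fin.Subset.Properties using (_∈?_; anySubset?; ∣p∣≤n; ∉⊥; ∣⊥∣≡0)
open import Data.List.Base as List using (List; length; filter; allFin; cartesianProductWith)
open import Data.List.Properties using (filter-≐)
import Data.List.Membership.Propositional as List
import Data.List.Membership.Propositional.Properties as List
import Data.List.Relation.Unary.Any as Any
import Data.List.Relation.Unary.Any.Properties as Any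
open import Data.Nat.Base
open import Data.Nat.Properties
open import Data.Product.Base using (∃; ∃-syntax; _×_; _,_; proj₁; proj₂)
open import Data.Vec.Base as Vec using (Vec; []; _∷_; _∷ʳ_; head; tail; init; lookup; map; tabulate)
open import Data.Vec.Properties using (≡-dec; tabulate∘lookup; lookup∘tabulate; map-cong; []=⇒lookup; lookup⇒[]=)
open import Data.Vec.Relation.Unary.All as All using (All)
open import Data.Vec.Relation.Unary.AllPairs using (allPairs?)
open import Data.Vec.Relation.Unary.Linked using (Linked; linked?)
open import Data.Vec.Relation.Unary.Unique.Propositional using (Unique)
import Data.Vec.Relation.Unary.Unique.Propositional.Properties as Unique
open import Function.Base using (_∘_)
open import Function.Bundles using (_⇔_; mk⇔; Equivalence)
open import Function.Definitions using (Injective)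
open import Level using (Level; 0ℓ)
open import Relation.Binary.Core using (Rel)
import Relation.Binary.Definitions as Binary
open import Relation.Binary.PropositionalEquality
open import Relation.Nullary using (¬_; Dec; does; yes; no; contradiction)
open import Relation.Nullary.Decidable as Dec using (map′; ¬?; _×-dec_; _→-dec_; decidable-stable; dec-true)
open import Relation.Unary using (Pred; Decidable)

private variable
  ℓ : Level
  k m n r s N : ℕ

IsMaximum : Pred ℕ ℓ → ℕ → Set ℓ
IsMaximum P m = P m × (∀ s → P s → s ≤ m)

-- The largest s ≤ b satisfying P (and 0 if there is none).
greatest : {P : Pred ℕ ℓ} → Decidable P → (b : ℕ) → ℕ
greatest P? zero    = zero
greatest P? (suc b) = if does (P? (suc b)) then suc b else greatest P? b

greatest-isMaximum : {P : Pred ℕ ℓ} (P? : Decidable P) {b : ℕ} →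
                     P 0 → (∀ s → P s → s ≤ b) → IsMaximum P (greatest P? b)
greatest-isMaximum {P = P} P? {b} P0 bound = holds b , λ s Ps → upper b s (bound s Ps) Ps
  where
  holds : ∀ b → P (greatest P? b)
  holds zero    = P0
  holds (suc b) with P? (suc b)
  ... | yes p = p
  ... | no  _ = holds b

  upper : ∀ b s → s ≤ b → P s → s ≤ greatest P? b
  upper zero    s s≤b Ps = s≤b
  upper (suc b) s s≤b Ps with P? (suc b)
  ... | yes _  = s≤b
  ... | no ¬p = upper b s (s≤s⁻¹ (≤∧≢⇒< s≤b λ { refl → ¬p Ps })) Ps

unique? : Decidable (Unique {A = Fin n} {m})
unique? = allPairs? λ i j → ¬? (i Fin.≟ j)

_≟ᵛ_ : Binary.DecidableEquality (Vec (Fin n) r)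
_≟ᵛ_ = ≡-dec Fin._≟_

anyVec? : {P : Pred (Vec (Fin n) r) ℓ} → Decidable P → Dec (∃ P)
anyVec? {r = zero}  P? = map′ (λ p → [] , p) (λ { ([] , p) → p }) (P? [])
anyVec? {r = suc r} P? =
  map′ (λ { (x , v , p) → x ∷ v , p }) (λ { (x ∷ v , p) → x , v , p })
       (Fin.any? λ x → anyVec? λ v → P? (x ∷ v))

allVec? : {P : Pred (Vec (Fin n) r) ℓ} → Decidable P → Dec (∀ v → P v)
allVec? P? =
  map′ (λ ¬∃ v → decidable-stable (P? v) λ ¬p → ¬∃ (v , ¬p)) (λ ∀P (v , ¬p) → ¬p (∀P v))
       (¬? (anyVec? λ v → ¬? (P? v)))

allSubset? : {P : Pred (Subset n) ℓ} → Decidable P → Dec (∀ S → P S)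
allSubset? P? =
  map′ (λ ¬∃ S → decidable-stable (P? S) λ ¬p → ¬∃ (S , ¬p)) (λ ∀P (S , ¬p) → ¬p (∀P S))
       (¬? (anySubset? λ S → ¬? (P? S)))

vectors : ∀ n r → List (Vec (Fin n) r)
vectors n zero    = [] List.∷ List.[]
vectors n (suc r) = cartesianProductWith _∷_ (allFin n) (vectors n r)

∈-vectors : (v : Vec (Fin n) r) → v List.∈ vectors n r
∈-vectors []      = Any.here refl
∈-vectors (x ∷ v) = List.∈-cartesianProductWith⁺ _∷_ (List.∈-allFin x) (∈-vectors v)

-- Only used when ∣ S ∣ ≡ r, where r distinct entries from S exhaust S.
IsOrdering : Subset n → Pred (Vec (Fin n) r) 0ℓ
IsOrdering S v = Unique v × All (_∈ S) v

isOrdering? : (S : Subset n) → Decidable (IsOrdering {r = r} S)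
isOrdering? S v = unique? v ×-dec All.all? (_∈? S) v

orderings : ∀ r → Subset n → List (Vec (Fin n) r)
orderings r S = filter (isOrdering? S) (vectors _ r)

record RDigraph (r n : ℕ) : Set₁ where
  field
    Edge     : Pred (Vec (Fin n) r) 0ℓ
    edge?    : Decidable Edge
    distinct : ∀ {e} → Edge e → Unique e

open RDigraph public

IsTournament : ℕ → RDigraph r n → Set
IsTournament {r} {n} k G =
  (S : Subset n) → ∣ S ∣ ≡ r → length (filter (edge? G) (orderings r S)) ≡ k

Contains : RDigraph r n → RDigraph r s → Set
Contains {n = n} {s = s} G H =
  ∃[ φ ] Injective {A = Fin s} {B = Fin n} _≡_ _≡_ φ × (∀ {e} → Edge H e → Edge G (map φ e))

-- The suc s ∸ r edges are the lists (i , i + 1 , … , i + r - 1) with entries below s.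
tightPath : ∀ r s → RDigraph r s
tightPath r s = record
  { Edge     = λ e → ∃[ i ] Consecutive i e
  ; edge?    = λ e → Fin.any? λ i → Fin.all? λ j → toℕ (lookup e j) ≟ toℕ i + toℕ j
  ; distinct = λ {e} (i , c) → subst Unique (tabulate∘lookup e)
      (Unique.tabulate⁺ λ {j} {j′} eq → Fin.toℕ-injective (+-cancelˡ-≡ (toℕ i) (toℕ j) (toℕ j′)
        (trans (sym (c j)) (trans (cong toℕ eq) (c j′)))))
  }
  where
  Consecutive : Fin (suc s ∸ r) → Vec (Fin s) r → Set
  Consecutive i e = ∀ j → toℕ (lookup e j) ≡ toℕ i + toℕ j

Forced : (n r k s : ℕ) → Set₁
Forced n r k s = (G : RDigraph r n) → IsTournament k G → Contains G (tightPath r s)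

isTournament? : ∀ k (G : RDigraph r n) → Dec (IsTournament k G)
isTournament? {r} k G = allSubset? λ S →
  (∣ S ∣ ≟ r) →-dec (length (filter (edge? G) (orderings r S)) ≟ k)

contains? : (G : RDigraph r n) (H : RDigraph r s) → Dec (Contains G H)
contains? {r} {n} {s} G H = map′ to from (anyVec? λ w →
    unique? w ×-dec allVec? λ e → edge? H e →-dec edge? G (map (lookup w) e))
  where
  Placement : Vec (Fin n) s → Set
  Placement w = Unique w × (∀ e → Edge H e → Edge G (map (lookup w) e))

  to : ∃ Placement → Contains G H
  to (w , u , h) = lookup w , (λ {i} {j} → Unique.lookup-injective u i j) , λ {e} → h e

  from : Contains G H → ∃ Placement
  from (φ , inj , h) = tabulate φ , Unique.tabulate⁺ inj , λ e He →
    subst (Edge G) (sym (map-cong (lookup∘tabulate φ) e)) (h He)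

private
  injections : ∀ n r → List (Vec (Fin n) r)
  injections n r = filter unique? (vectors n r)

  fromSubset : Subset (length (injections n r)) → RDigraph r n
  fromSubset {n} {r} T = record
    { Edge     = λ e → ∃[ i ] i ∈ T × List.lookup (injections n r) i ≡ e
    ; edge?    = λ e → Fin.any? λ i → (i ∈? T) ×-dec (List.lookup (injections n r) i ≟ᵛ e)
    ; distinct = λ { (i , _ , refl) →
        proj₂ (List.∈-filter⁻ unique? {xs = vectors n r} (List.∈-lookup i)) }
    }

  toSubset : RDigraph r n → Subset (length (injections n r))
  toSubset {r} {n} G = tabulate λ i → does (edge? G (List.lookup (injections n r) i))

  fromSubset⁺ : (G : RDigraph r n) → ∀ {e} → Edge G e → Edge (fromSubset (toSubset G)) e
  fromSubset⁺ {r} {n} G {e} Ge = i , lookup⇒[]= i _ (trans (lookup∘tabulate _ i)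
      (dec-true (edge? G _) (subst (Edge G) e≡ Ge))) , sym e≡
    where
    e∈ : e List.∈ injections n r
    e∈ = List.∈-filter⁺ unique? (∈-vectors e) (distinct G Ge)
    i  = Any.index e∈
    e≡ : e ≡ List.lookup (injections n r) i
    e≡ = Any.lookup-index e∈

  fromSubset⁻ : (G : RDigraph r n) → ∀ {e} → Edge (fromSubset (toSubset G)) e → Edge G e
  fromSubset⁻ {r} {n} G (i , i∈ , refl)
    with edge? G (List.lookup (injections n r) i)
       | trans (sym (lookup∘tabulate (λ i → does (edge? G (List.lookup (injections n r) i))) i)) ([]=⇒lookup i∈)
  ... | yes p | _ = p
  ... | no  _ | ()

forced? : ∀ n r k → Decidable (Forced n r k)
forced? n r k s = map′ to (λ h T → h (fromSubset T)) (allSubset? λ T →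
    isTournament? k (fromSubset T) →-dec contains? (fromSubset T) (tightPath r s))
  where
  to : (∀ T → IsTournament k (fromSubset T) → Contains (fromSubset T) (tightPath r s)) →
       Forced n r k s
  to h G tour = let φ , inj , emb = h (toSubset G) tour′ in
                φ , inj , λ He → fromSubset⁻ G (emb He)
    where
    tour′ : IsTournament k (fromSubset (toSubset G))
    tour′ S eq = trans (cong length (filter-≐ (edge? (fromSubset (toSubset G))) (edge? G)
      (fromSubset⁻ G , fromSubset⁺ G) (orderings r S))) (tour S eq)

-- For k ≤ r ! there are (r , k)-tournaments on n vertices, and then s ≤ n whenever
-- Forced n r k s, so the search up to n finds the maximum (f-isMaximum).
f : (n r k : ℕ) → ℕ
f n r k = greatest (forced? n r k) n

f-isMaximum : .{{_ : NonZero r}} (G : RDigraph r n) → IsTournament k G →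
              IsMaximum (Forced n r k) (f n r k)
f-isMaximum {suc r} {n} {k} G tour = greatest-isMaximum (forced? n (suc r) k) forced₀
    λ s forced → Fin.injective⇒≤ (proj₁ (proj₂ (forced G tour)))
  where
  forced₀ : Forced n (suc r) k 0
  forced₀ _ _ = (λ ()) , (λ { {()} }) , λ { {() ∷ _} }

record Digraph (N : ℕ) : Set₁ where
  field
    _⟶_  : Rel (Fin N) 0ℓ
    _⟶?_ : Binary.Decidable _⟶_

-- A directed cycle with all its vertices in W; a loop is a cycle with one vertex.
HasCycle : Digraph N → Subset N → Set
HasCycle {N} G W = ∃[ m ] ∃[ c ]
    Unique {A = Fin N} {n = suc m} c × All (_∈ W) c × Linked _⟶_ (c ∷ʳ head c)
  where open Digraph G

hasCycle? : (G : Digraph N) → Decidable (HasCycle G)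
hasCycle? {N} G W = map′ (λ (i , p) → toℕ i , p) from (Fin.any? λ i → cycle? (toℕ i))
  where
  open Digraph G

  Cycle : ℕ → Set
  Cycle m = ∃[ c ] Unique {A = Fin N} {n = suc m} c × All (_∈ W) c × Linked _⟶_ (c ∷ʳ head c)

  cycle? : ∀ m → Dec (Cycle m)
  cycle? m = anyVec? λ c → unique? c ×-dec All.all? (_∈? W) c ×-dec linked? _⟶?_ (c ∷ʳ head c)

  from : HasCycle G W → ∃[ i ] Cycle (toℕ {N} i)
  from (m , c , u , p) = Fin.fromℕ< m<N , subst Cycle (sym (Fin.toℕ-fromℕ< m<N)) (c , u , p)
    where
    m<N : m < N
    m<N = Fin.injective⇒≤ λ {i} {j} → Unique.lookup-injective u i j

HasAcyclicSet : Digraph N → ℕ → Set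
HasAcyclicSet {N} G s = ∃[ W ] ∣ W ∣ ≡ s × ¬ HasCycle {N} G W

hasAcyclicSet? : (G : Digraph N) → Decidable (HasAcyclicSet G)
hasAcyclicSet? G s = anySubset? λ W → (∣ W ∣ ≟ s) ×-dec ¬? (hasCycle? G W)

a : Digraph N → ℕ
a {N} G = greatest (hasAcyclicSet? G) N

a-isMaximum : (G : Digraph N) → IsMaximum (HasAcyclicSet G) (a G)
a-isMaximum {N} G = greatest-isMaximum (hasAcyclicSet? G)
    (_ , ∣⊥∣≡0 N , λ { (_ , _ ∷ _ , _ , x∈ All.∷ _ , _) → ∉⊥ x∈ })
    (λ { _ (W , refl , _) → ∣p∣≤n W })

PatternMatch : Rel (Vec (Fin n) m) 0ℓ
PatternMatch v w =
  ∀ i j → i Fin.< j → (lookup v i Fin.< lookup v j) ⇔ (lookup w i Fin.< lookup w j)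

patternMatch? : Binary.Decidable (PatternMatch {n} {m})
patternMatch? v w = Fin.all? λ i → Fin.all? λ j → (i Fin.<? j) →-dec
  map′ (λ (p , q) → mk⇔ p q) (λ e → Equivalence.to e , Equivalence.from e)
    (((lookup v i Fin.<? lookup v j) →-dec (lookup w i Fin.<? lookup w j)) ×-dec
     ((lookup w i Fin.<? lookup w j) →-dec (lookup v i Fin.<? lookup v j)))

permutations : ∀ r → List (Vec (Fin r) r)
permutations r = orderings r ⊤

-- Vertex i stands for the i-th permutation in the list.
PSG : ∀ r .{{_ : NonZero r}} → Digraph (length (permutations r))
PSG (suc r) = record
  { _⟶_  = λ i j → PatternMatch (tail (perm i)) (init (perm j))
  ; _⟶?_ = λ i j → patternMatch? (tail (perm i)) (init (perm j))
  }
  where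
  perm : Fin (length (permutations (suc r))) → Vec (Fin (suc r)) (suc r)
  perm = List.lookup (permutations (suc r))

BoundedAtInfinity : (ℕ → ℕ) → Set
BoundedAtInfinity g = ∃[ C ] ∃[ n₀ ] ∀ n → n₀ ≤ n → g n ≤ C

TendsToInfinity : (ℕ → ℕ) → Set
TendsToInfinity g = ∀ M → ∃[ n₀ ] ∀ n → n₀ ≤ n → M ≤ g n

-- k is restricted to k ≤ r ! because no (r , k)-tournament on n ≥ r vertices
-- exists for larger k.
IsThreshold : (r t : ℕ) → Set
IsThreshold r t =
  (t ≤ r ! × TendsToInfinity (λ n → f n r t)) ×
  (∀ k → k ≤ r ! → TendsToInfinity (λ n → f n r k) → t ≤ k)

{-# OPTIONS --safe #-}
module Submission where

-- If W is acyclic in PSG, take as edges the lists whose order type lies in W; along a tight path the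
-- order types of consecutive windows form a walk in W, so the path has fewer than ∣ V(PSG) ∣ + r
-- vertices. If k > a(PSG), Ramsey's theorem, with an increasing r-tuple coloured by the set of order
-- types of its orderings that are edges, gives a large set on which this set is a constant W of size
-- k. W contains a cycle of PSG. Following it backwards and prepending entries one at a time yields a
-- sequence of distinct numbers, as long as desired, all of whose windows have order types in W;
-- placing it in the homogeneous set gives a long tight path.

open import Defs
open import Data.Bool.Base using (Bool; true; false)
open import Data.Fin.Base as Fin using (Fin; zero; suc; toℕ; fromℕ<; inject₁; combine; punchOut)
import Data.Fin.Properties as Fin
open import Data.Fin.Subset using (Subset; inside; outside; ⊤; ⊥; ⁅_⁆; _∪_; _∈_; _∉_; _⊆_; ∣_∣)
open import Data.Fin.Subset.Properties
  using (_∈?_; ∈⊤; ∉⊥; ∣⊥∣≡0; ∣p∣≤n; ∣p∣≡n⇒p≡⊤; ∪-identityˡ; x∈p∪q⁺; x∈p∪q⁻; x∈⁅x⁆; x∈⁅y⁆⇒x≡y; ⊆-antisym)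
open import Data.List.Base as List using (List; []; _∷_; length; filter; allFin)
import Data.List.Membership.Propositional as List
import Data.List.Membership.Propositional.Properties as List
open import Data.List.Membership.Propositional.Properties.WithK using (unique∧set⇒bag)
import Data.List.Properties as List
open import Data.List.Relation.Binary.BagAndSetEquality using (∼bag⇒↭)
open import Data.List.Relation.Binary.Permutation.Propositional.Properties using (↭-length)
open import Data.List.Relation.Binary.Sublist.Propositional as Sublist
  using ([]; _∷_) renaming (_⊆_ to _⊑_; _∷ʳ_ to _∷ʳ′_)
import Data.List.Relation.Binary.Sublist.Propositional.Properties as Sublist
open import Data.List.Relation.Unary.All as ListAll using ([]; _∷_)
open import Data.List.Relation.Unary.AllPairs as ListAllPairs using ([]; _∷_)
import Data.List.Relation.Unary.AllPairs.Properties as ListAllPairs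
open import Data.List.Relation.Unary.Any as Any using (here; there)
import Data.List.Relation.Unary.Any.Properties as Any
import Data.List.Relation.Unary.Unique.Propositional as List
import Data.List.Relation.Unary.Unique.Propositional.Properties as ListUnique
open import Data.Nat.Base
open import Data.Nat.Properties
open import Data.Product.Base using (∃-syntax; _×_; _,_; proj₁; proj₂)
open import Data.Sum.Base using (_⊎_; inj₁; inj₂)
open import Data.Vec.Base as Vec using (Vec; []; _∷_; _∷ʳ_; head; tail; init; lookup; map; tabulate)
import Data.Vec.Membership.Propositional as Vec
import Data.Vec.Properties as Vec
open import Data.Vec.Properties using (lookup-map; lookup∘tabulate; tabulate∘lookup; tabulate-∘; tabulate-cong)
open import Data.Vec.Relation.Unary.All as All using (All; []; _∷_)
import Data.Vec.Relation.Unary.All.Properties as All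
open import Data.Vec.Relation.Unary.AllPairs as AllPairs using (AllPairs; []; _∷_; allPairs?)
import Data.Vec.Relation.Unary.AllPairs.Properties as AllPairs
import Data.Vec.Relation.Unary.Any as VecAny
open import Data.Vec.Relation.Unary.Linked using (Linked; []; [-]; _∷_)
open import Data.Vec.Relation.Unary.Unique.Propositional using (Unique)
import Data.Vec.Relation.Unary.Unique.Propositional.Properties as Unique
open import Function.Base using (_∘_; id)
open import Function.Bundles using (_⇔_; mk⇔; Equivalence)
open import Function.Definitions using (Injective)
open import Level using (Level; 0ℓ)
open import Relation.Binary.Definitions using (tri<; tri≈; tri>)
open import Relation.Binary.PropositionalEquality
open import Relation.Nullary using (¬_; does; yes; no; contradiction)
open import Relation.Nullary.Decidable using (dec-true; _×-dec_; decidable-stable)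
open import Relation.Unary using (Pred; Decidable)

private variable
  ℓ : Level
  A B : Set ℓ
  k m n r s N : ℕ

open Equivalence using (to; from)

-- Finite maps, lists and vectors

-- A missed value `y` could be punched out of the codomain, leaving an injection into a smaller
-- `Fin`.
injective⇒surjective : {g : Fin n → Fin n} → Injective _≡_ _≡_ g → ∀ y → ∃[ x ] g x ≡ y
injective⇒surjective {suc n} {g} inj y with Fin.any? (λ x → g x Fin.≟ y)
... | yes p = p
... | no ¬p = contradiction (Fin.injective⇒≤ punched-injective) 1+n≰n
  where
  y≢ : ∀ x → y ≢ g x
  y≢ x eq = ¬p (x , sym eq)

  punched-injective : Injective _≡_ _≡_ (λ x → punchOut (y≢ x))
  punched-injective eq = inj (Fin.punchOut-injective (y≢ _) (y≢ _) eq)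

list-lookup-injective : {xs : List A} → List.Unique xs →
                        ∀ i j → List.lookup xs i ≡ List.lookup xs j → i ≡ j
list-lookup-injective (x∉ ∷ _) zero    zero    eq = refl
list-lookup-injective (x∉ ∷ _) zero    (suc j) eq = contradiction eq (ListAll.lookup x∉ (List.∈-lookup j))
list-lookup-injective (x∉ ∷ _) (suc i) zero    eq = contradiction (sym eq) (ListAll.lookup x∉ (List.∈-lookup i))
list-lookup-injective (_ ∷ u)  (suc i) (suc j) eq = cong suc (list-lookup-injective u i j eq)

vec-ext : {v w : Vec A n} → (∀ i → lookup v i ≡ lookup w i) → v ≡ w
vec-ext {v = v} {w} eq = trans (sym (tabulate∘lookup v)) (trans (tabulate-cong eq) (tabulate∘lookup w))

lookup-init : (v : Vec A (suc n)) (i : Fin n) → lookup (init v) i ≡ lookup v (inject₁ i)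
lookup-init (x ∷ v) zero    = helper v
  where
  helper : {x : A} (v : Vec A (suc n)) → lookup (init (x ∷ v)) zero ≡ x
  helper (y ∷ v) = refl
lookup-init (x ∷ v) (suc i) = lookup-init v i

∣tabulate∣≡length-filter : {P : Pred A ℓ} (P? : Decidable P) (xs : List A) →
  ∣ tabulate (λ i → does (P? (List.lookup xs i))) ∣ ≡ length (filter P? xs)
∣tabulate∣≡length-filter P? []       = refl
∣tabulate∣≡length-filter P? (x ∷ xs) with does (P? x)
... | true  = cong suc (∣tabulate∣≡length-filter P? xs)
... | false = ∣tabulate∣≡length-filter P? xs

∈-tabulate⁺ : {P : Pred (Fin n) ℓ} (P? : Decidable P) → ∀ {i} → P i → i ∈ tabulate (does ∘ P?)
∈-tabulate⁺ P? {i} p = Vec.lookup⇒[]= i _ (trans (lookup∘tabulate _ i) (dec-true (P? i) p))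

∈-tabulate⁻ : {P : Pred (Fin n) ℓ} (P? : Decidable P) → ∀ {i} → i ∈ tabulate (does ∘ P?) → P i
∈-tabulate⁻ P? {i} i∈ with P? i | trans (sym (lookup∘tabulate (does ∘ P?) i)) (Vec.[]=⇒lookup i∈)
... | yes p | _ = p
... | no  _ | ()

Increasing : Pred (Vec (Fin n) m) _
Increasing = AllPairs Fin._<_

increasing? : Decidable (Increasing {n} {m})
increasing? = allPairs? Fin._<?_

increasing⇒unique : {v : Vec (Fin n) m} → Increasing v → Unique v
increasing⇒unique = AllPairs.map Fin.<⇒≢

AllPairs-lookup : {R : A → A → Set ℓ} {v : Vec A n} → AllPairs R v →
                  ∀ {i j} → i Fin.< j → R (lookup v i) (lookup v j)
AllPairs-lookup (px ∷ _) {zero}  {suc j} _   = All.lookup⁺ px j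
AllPairs-lookup (_ ∷ ps) {suc i} {suc j} i<j = AllPairs-lookup ps (s<s⁻¹ i<j)

-- Permutations and the orderings of a set

vectors-unique : ∀ n r → List.Unique (vectors n r)
vectors-unique n zero    = [] ∷ []
vectors-unique n (suc r) =
  ListUnique.cartesianProductWith⁺ _∷_ Vec.∷-injective (ListUnique.allFin⁺ n) (vectors-unique n r)

orderings-unique : ∀ r (S : Subset n) → List.Unique (orderings r S)
orderings-unique r S = ListUnique.filter⁺ (isOrdering? S) (vectors-unique _ r)

perm : ∀ r → Fin (length (permutations r)) → Vec (Fin r) r
perm r = List.lookup (permutations r)

∈-permutations : {v : Vec (Fin r) r} → Unique v → v List.∈ permutations r
∈-permutations {v = v} u =
  List.∈-filter⁺ (isOrdering? ⊤) (∈-vectors v) (u , All.lookup⁻ λ _ → ∈⊤)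

perm-unique : ∀ r i → Unique (perm r i)
perm-unique r i = proj₁ (proj₂ (List.∈-filter⁻ (isOrdering? ⊤) {xs = vectors r r} (List.∈-lookup i)))

perm-injective : ∀ r i j → perm r i ≡ perm r j → i ≡ j
perm-injective r = list-lookup-injective (orderings-unique r ⊤)

perm-index : {v : Vec (Fin r) r} → Unique v → ∃[ i ] perm r i ≡ v
perm-index u = Any.index (∈-permutations u) , sym (Any.lookup-index (∈-permutations u))

-- When v is increasing this is the set of order types that P accepts on the entries of v.
patternsAt : {P : Pred (Vec (Fin n) r) ℓ} → Decidable P → Vec (Fin n) r → Subset (length (permutations r))
patternsAt P? v = tabulate λ i → does (P? (map (lookup v) (perm _ i)))

-- As `v` enumerates `S` without repetition, `map (lookup v)` is a bijection from the permutations
-- to the orderings of `S`. The two filtered lists have the same members and no repetitions, hence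
-- equal length. This turns the tournament condition into the size of a set of order types.
length-orderings : {P : Pred (Vec (Fin n) r) ℓ} (P? : Decidable P) (S : Subset n) (v : Vec (Fin n) r) →
  Unique v → (∀ i → lookup v i ∈ S) → (∀ {x} → x ∈ S → ∃[ i ] lookup v i ≡ x) →
  length (filter P? (orderings r S)) ≡ ∣ patternsAt P? v ∣
length-orderings {n = n} {r} {P = P} P? S v u v∈S S⊆v =
  trans (↭-length (∼bag⇒↭ (unique∧set⇒bag orderings! arranged! (mk⇔ arrange unarrange))))
    (trans (List.length-map place (filter (P? ∘ place) (permutations r)))
      (sym (∣tabulate∣≡length-filter (P? ∘ place) (permutations r))))
  where
  place : Vec (Fin r) r → Vec (Fin n) r
  place = map (lookup v)

  v-injective : ∀ {i j} → lookup v i ≡ lookup v j → i ≡ j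
  v-injective = Unique.lookup-injective u _ _

  place-injective : ∀ {p q} → place p ≡ place q → p ≡ q
  place-injective {p} {q} eq = vec-ext λ i → v-injective
    (trans (sym (lookup-map i _ p)) (trans (cong (λ w → lookup w i) eq) (lookup-map i _ q)))

  arranged : List (Vec (Fin n) r)
  arranged = List.map place (filter (P? ∘ place) (permutations r))

  orderings! : List.Unique (filter P? (orderings r S))
  orderings! = ListUnique.filter⁺ P? (orderings-unique r S)

  arranged! : List.Unique arranged
  arranged! = ListUnique.map⁺ place-injective (ListUnique.filter⁺ (P? ∘ place) (orderings-unique r ⊤))

  arrange : ∀ {w} → w List.∈ filter P? (orderings r S) → w List.∈ arranged
  arrange {w} w∈ = subst (List._∈ arranged) place-p
      (List.∈-map⁺ place (List.∈-filter⁺ (P? ∘ place) (∈-permutations p!)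
        (subst P (sym place-p) (proj₂ (List.∈-filter⁻ P? {xs = orderings r S} w∈)))))
    where
    ordering : IsOrdering S w
    ordering = proj₂ (List.∈-filter⁻ (isOrdering? S) {xs = vectors n r}
      (proj₁ (List.∈-filter⁻ P? {xs = orderings r S} w∈)))

    position : ∀ j → ∃[ i ] lookup v i ≡ lookup w j
    position j = S⊆v (All.lookup⁺ (proj₂ ordering) j)

    p : Vec (Fin r) r
    p = tabulate (proj₁ ∘ position)

    p! : Unique p
    p! = Unique.tabulate⁺ λ {i} {j} eq → Unique.lookup-injective (proj₁ ordering) i j
      (trans (sym (proj₂ (position i))) (trans (cong (lookup v) eq) (proj₂ (position j))))

    place-p : place p ≡ w
    place-p = trans (sym (tabulate-∘ (lookup v) (proj₁ ∘ position)))
      (trans (tabulate-cong (proj₂ ∘ position)) (tabulate∘lookup w))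

  unarrange : ∀ {w} → w List.∈ arranged → w List.∈ filter P? (orderings r S)
  unarrange w∈ with p , p∈ , refl ← List.∈-map⁻ place w∈ =
    List.∈-filter⁺ P? (List.∈-filter⁺ (isOrdering? S) (∈-vectors _)
      (Unique.map⁺ v-injective (proj₁ (proj₂ (List.∈-filter⁻ (isOrdering? ⊤) {xs = vectors r r} p∈p))) ,
       All.map⁺ (All.lookup⁻ λ _ → v∈S _)))
      (proj₂ p∈Q)
    where
    p∈Q = List.∈-filter⁻ (P? ∘ place) {xs = permutations r} p∈
    p∈p = proj₁ p∈Q

-- Lehmer codes and the number of permutations

punchOutAll : (x : Fin (suc n)) {v : Vec (Fin (suc n)) m} → All (x ≢_) v → Vec (Fin n) m
punchOutAll x []         = []
punchOutAll x (x≢ ∷ x≢s) = punchOut x≢ ∷ punchOutAll x x≢s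

punchOutAll-injective : (x : Fin (suc n)) {v w : Vec (Fin (suc n)) m} (p : All (x ≢_) v) (q : All (x ≢_) w) →
  punchOutAll x p ≡ punchOutAll x q → v ≡ w
punchOutAll-injective x []      []      eq = refl
punchOutAll-injective x (p ∷ ps) (q ∷ qs) eq =
  cong₂ _∷_ (Fin.punchOut-injective p q (Vec.∷-injectiveˡ eq))
    (punchOutAll-injective x ps qs (Vec.∷-injectiveʳ eq))

punchOutAll-unique : (x : Fin (suc n)) {v : Vec (Fin (suc n)) m} (p : All (x ≢_) v) →
  Unique v → Unique (punchOutAll x p)
punchOutAll-unique x []       []       = []
punchOutAll-unique x (p ∷ ps) (u ∷ us) = head! ps u ∷ punchOutAll-unique x ps us
  where
  head! : ∀ {m y} {x≢y : x ≢ y} {v : Vec _ m} (ps : All (x ≢_) v) → All (y ≢_) v →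
          All (punchOut x≢y ≢_) (punchOutAll x ps)
  head! []       []       = []
  head! {x≢y = x≢y} (p ∷ ps) (u ∷ us) = (λ eq → u (Fin.punchOut-injective x≢y p eq)) ∷ head! ps us

-- The Lehmer code in the factorial number system: the first entry is the leading digit, and the
-- other entries are relabelled by punching it out before they are coded in turn.
lehmer : {v : Vec (Fin r) r} → Unique v → Fin (r !)
lehmer {zero}              []      = zero
lehmer {suc r} {v = x ∷ v} (p ∷ u) = combine x (lehmer (punchOutAll-unique x p u))

lehmer-injective : {v w : Vec (Fin r) r} (u : Unique v) (u′ : Unique w) → lehmer u ≡ lehmer u′ → v ≡ w
lehmer-injective {zero}  {[]}    {[]}    _       _         _  = refl
lehmer-injective {suc r} {x ∷ v} {y ∷ w} (p ∷ u) (p′ ∷ u′) eq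
  with refl , eq′ ← Fin.combine-injective x (lehmer (punchOutAll-unique x p u))
                                          y (lehmer (punchOutAll-unique y p′ u′)) eq =
  cong (x ∷_) (punchOutAll-injective x p p′
    (lehmer-injective (punchOutAll-unique x p u) (punchOutAll-unique x p′ u′) eq′))

∣permutations∣≤r! : ∀ r → length (permutations r) ≤ r !
∣permutations∣≤r! r = Fin.injective⇒≤ {f = λ i → lehmer (perm-unique r i)} λ {i} {j} eq →
  perm-injective r i j (lehmer-injective (perm-unique r i) (perm-unique r j) eq)

-- Order types

-- Stated for functions into `ℕ`, so that vectors over different `Fin n` and windows of infinite
-- sequences can be compared with each other.
SameOrder : (Fin m → ℕ) → (Fin m → ℕ) → Set
SameOrder x y = ∀ i j → x i < x j ⇔ y i < y j

sameOrder-sym : {x y : Fin m → ℕ} → SameOrder x y → SameOrder y x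
sameOrder-sym x≈y i j = mk⇔ (from (x≈y i j)) (to (x≈y i j))

sameOrder-trans : {x y z : Fin m → ℕ} → SameOrder x y → SameOrder y z → SameOrder x z
sameOrder-trans x≈y y≈z i j = mk⇔ (to (y≈z i j) ∘ to (x≈y i j)) (from (x≈y i j) ∘ from (y≈z i j))

sameOrder-cong : {x x′ y y′ : Fin m → ℕ} → (∀ i → x i ≡ x′ i) → (∀ i → y i ≡ y′ i) →
                 SameOrder x y → SameOrder x′ y′
sameOrder-cong x≡ y≡ x≈y i j = mk⇔
  (subst₂ _<_ (y≡ i) (y≡ j) ∘ to (x≈y i j) ∘ subst₂ _<_ (sym (x≡ i)) (sym (x≡ j)))
  (subst₂ _<_ (x≡ i) (x≡ j) ∘ from (x≈y i j) ∘ subst₂ _<_ (sym (y≡ i)) (sym (y≡ j)))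

-- One direction suffices: by trichotomy, failure of `x i < x j` means `i ≡ j` or `x j < x i`, and
-- either contradicts `y i < y j`.
sameOrder⁺ : {x y : Fin m → ℕ} → Injective _≡_ _≡_ x → (∀ i j → x i < x j → y i < y j) → SameOrder x y
sameOrder⁺ {x = x} {y} x-injective mono i j = mk⇔ (mono i j) reflect
  where
  reflect : y i < y j → x i < x j
  reflect y< with <-cmp (x i) (x j)
  ... | tri< x< _ _ = x<
  ... | tri≈ _ x≡ _ with refl ← x-injective x≡ = contradiction y< (<-irrefl refl)
  ... | tri> _ _ x> = contradiction y< (<-asym (mono j i x>))

values : Vec (Fin n) m → Fin m → ℕ
values v = toℕ ∘ lookup v

values-injective : {v : Vec (Fin n) m} → Unique v → Injective _≡_ _≡_ (values v)
values-injective u eq = Unique.lookup-injective u _ _ (Fin.toℕ-injective eq)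

increasing-map : {v : Vec (Fin n) m} → Increasing v → {p : Vec (Fin m) s} → Unique p →
                 SameOrder (values p) (values (map (lookup v) p))
increasing-map {v = v} v↑ {p} u = sameOrder⁺ (values-injective u) λ i j pᵢ<pⱼ →
  subst₂ (λ x y → toℕ x < toℕ y) (sym (lookup-map i (lookup v) p)) (sym (lookup-map j (lookup v) p))
    (AllPairs-lookup v↑ pᵢ<pⱼ)

-- Induction on the value `x`: a permutation `p` also takes the value just below, at some `j`, and
-- `q` increases strictly from `j` to `i`. Used in both directions, this shows that a permutation is
-- determined by its order type.
values-≤ : (p q : Vec (Fin r) r) → Unique p → SameOrder (values p) (values q) →
           ∀ x i → values p i ≡ x → x ≤ values q i
values-≤         p q u p≈q zero    i eq = z≤n
values-≤ {r = r} p q u p≈q (suc x) i eq = ≤-trans (s≤s (values-≤ p q u p≈q x j pⱼ≡x)) (to (p≈q j i) pⱼ<pᵢ)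
  where
  x<r : x < r
  x<r = <-trans (subst (x <_) (sym eq) (n<1+n x)) (Fin.toℕ<n (lookup p i))

  preimage : ∃[ j ] lookup p j ≡ fromℕ< x<r
  preimage = injective⇒surjective (Unique.lookup-injective u _ _) (fromℕ< x<r)

  j : Fin r
  j = proj₁ preimage

  pⱼ≡x : values p j ≡ x
  pⱼ≡x = trans (cong toℕ (proj₂ preimage)) (Fin.toℕ-fromℕ< x<r)

  pⱼ<pᵢ : values p j < values p i
  pⱼ<pᵢ = subst₂ _<_ (sym pⱼ≡x) (sym eq) (n<1+n x)

sameOrder⇒≡ : (p q : Vec (Fin r) r) → Unique p → Unique q → SameOrder (values p) (values q) → p ≡ q
sameOrder⇒≡ p q u u′ p≈q = vec-ext λ i → Fin.toℕ-injective
  (≤-antisym (values-≤ p q u p≈q _ i refl) (values-≤ q p u′ (sameOrder-sym p≈q) _ i refl))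

-- The tournament of a set of order types

elements : (S : Subset n) → Vec (Fin n) ∣ S ∣
elements []            = []
elements (inside ∷ S)  = zero ∷ map suc (elements S)
elements (outside ∷ S) = map suc (elements S)

elements-increasing : (S : Subset n) → Increasing (elements S)
elements-increasing []            = []
elements-increasing (inside ∷ S)  =
  All.map⁺ (All.universal (λ _ → z<s) _) ∷ AllPairs.map⁺ (AllPairs.map s<s (elements-increasing S))
elements-increasing (outside ∷ S) = AllPairs.map⁺ (AllPairs.map s<s (elements-increasing S))

elements-sound : (S : Subset n) → All (_∈ S) (elements S)
elements-sound []            = []
elements-sound (inside ∷ S)  = Vec.here ∷ All.map⁺ (All.map Vec.there (elements-sound S))
elements-sound (outside ∷ S) = All.map⁺ (All.map Vec.there (elements-sound S))

elements-complete : (S : Subset n) → ∀ {x} → x ∈ S → ∃[ i ] lookup (elements S) i ≡ x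
elements-complete (inside ∷ S)  Vec.here       = zero , refl
elements-complete (inside ∷ S)  (Vec.there x∈) with i , refl ← elements-complete S x∈ =
  suc i , lookup-map i suc (elements S)
elements-complete (outside ∷ S) (Vec.there x∈) with i , refl ← elements-complete S x∈ =
  i , lookup-map i suc (elements S)

-- That the order type of `w` lies in `W` is expressed by factoring `w` as an increasing vector
-- after a permutation in `W`. Both factors range over finite types, so edges are decided by search.
patternTournament : ∀ {n} r → Subset (length (permutations r)) → RDigraph r n
patternTournament {n} r W = record
  { Edge     = λ w → ∃[ i ] i ∈ W × ∃[ v ] Increasing v × w ≡ map (lookup {A = Fin n} v) (perm r i)
  ; edge?    = λ w → Fin.any? λ i → (i ∈? W) ×-dec
      anyVec? λ v → increasing? v ×-dec (w ≟ᵛ map (lookup v) (perm r i))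
  ; distinct = λ { (i , _ , v , v↑ , refl) →
      Unique.map⁺ (Unique.lookup-injective (increasing⇒unique v↑) _ _) (perm-unique r i) }
  }

patternsAt-patternTournament : (W : Subset (length (permutations r))) {v : Vec (Fin n) r} → Increasing v →
                               patternsAt (edge? (patternTournament r W)) v ≡ W
patternsAt-patternTournament {r} {n} W {v} v↑ = ⊆-antisym
  (λ {i} i∈ → from-edge i (∈-tabulate⁻ (edge? (patternTournament r W) ∘ arrangement) i∈))
  (λ {i} i∈ → ∈-tabulate⁺ (edge? (patternTournament r W) ∘ arrangement) (i , i∈ , v , v↑ , refl))
  where
  arrangement : Fin (length (permutations r)) → Vec (Fin n) r
  arrangement i = map (lookup v) (perm r i)

  -- The edge may come from another pair `j`, `v′`; but both factorisations have the order type of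
  -- the same list, which forces the permutations to agree.
  from-edge : ∀ i → Edge (patternTournament r W) (arrangement i) → i ∈ W
  from-edge i (j , j∈W , v′ , v′↑ , eq) = subst (_∈ W) (perm-injective r j i (sym same)) j∈W
    where
    same : perm r i ≡ perm r j
    same = sameOrder⇒≡ (perm r i) (perm r j) (perm-unique r i) (perm-unique r j)
      (sameOrder-trans (increasing-map v↑ (perm-unique r i))
        (subst (λ w → SameOrder (values w) (values (perm r j))) (sym eq)
          (sameOrder-sym (increasing-map v′↑ (perm-unique r j)))))

patternTournament-isTournament : (W : Subset (length (permutations r))) →
                                 IsTournament ∣ W ∣ (patternTournament {n} r W)
patternTournament-isTournament W S refl =
  trans (length-orderings (edge? (patternTournament _ W)) S (elements S) (increasing⇒unique S↑)
          (All.lookup⁺ (elements-sound S)) (elements-complete S))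
    (cong ∣_∣ (patternsAt-patternTournament W S↑))
  where
  S↑ = elements-increasing S

-- Cycles in long walks

-- The walk is cut at its first visit to `x`, and `c` is the part of `v` before that visit. The last
-- component says that `c` inherits every property of the entries of `v`; it later supplies
-- distinctness and membership in `W`.
first-return : {R : Fin N → Fin N → Set ℓ} (x y : Fin N) (v : Vec (Fin N) m) → Linked R (y ∷ v) → Unique v →
  All (x ≢_) v ⊎
  ∃[ l ] ∃[ c ] Unique {n = l} c × All (x ≢_) c × Linked R (y ∷ (c ∷ʳ x)) ×
    (∀ {P : Pred (Fin N) 0ℓ} → All P v → All P c)
first-return x y []      _          _        = inj₁ []
first-return x y (z ∷ v) (yRz ∷ lk) (z∉ ∷ u) with x Fin.≟ z
... | yes refl = inj₂ (0 , [] , [] , [] , yRz ∷ [-] , λ _ → [])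
... | no x≢z with first-return x z v lk u
...   | inj₁ x∉ = inj₁ (x≢z ∷ x∉)
...   | inj₂ (l , c , c! , x∉c , lk′ , sub) =
        inj₂ (suc l , z ∷ c , sub z∉ ∷ c! , x≢z ∷ x∉c , yRz ∷ lk′ , λ { (p ∷ ps) → p ∷ sub ps })

-- Once the tail is known to be free of repetitions, the first return to the head closes a cycle
-- whose vertices are distinct.
unique⊎cycle : (G : Digraph N) (W : Subset N) (v : Vec (Fin N) m) → Linked (Digraph._⟶_ G) v → All (_∈ W) v →
               Unique v ⊎ HasCycle G W
unique⊎cycle G W []      _  _        = inj₁ []
unique⊎cycle G W (x ∷ []) _ _        = inj₁ ([] ∷ [])
unique⊎cycle G W (x ∷ v@(_ ∷ _)) lk@(_ ∷ lk′) (x∈ ∷ v∈) with unique⊎cycle G W v lk′ v∈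
... | inj₂ cycle = inj₂ cycle
... | inj₁ u with first-return x x v lk u
...   | inj₁ x∉ = inj₁ (x∉ ∷ u)
...   | inj₂ (l , c , c! , x∉c , lkc , sub) = inj₂ (l , x ∷ c , x∉c ∷ c! , x∈ ∷ sub v∈ , lkc)

linked-tabulate : {R : A → A → Set ℓ} (g : Fin (suc m) → A) →
                  (∀ i → R (g (inject₁ i)) (g (suc i))) → Linked R (tabulate g)
linked-tabulate {m = zero}  g step = [-]
linked-tabulate {m = suc m} g step = step zero ∷ linked-tabulate (g ∘ suc) (step ∘ suc)

-- By pigeonhole, `suc N` vertices out of `N` cannot be distinct.
long-walk⇒cycle : (G : Digraph N) (W : Subset N) (g : Fin (suc N) → Fin N) →
  (∀ i → g i ∈ W) → (∀ i → Digraph._⟶_ G (g (inject₁ i)) (g (suc i))) → HasCycle G W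
long-walk⇒cycle G W g g∈ step with unique⊎cycle G W (tabulate g) (linked-tabulate g step) (All.tabulate⁺ g∈)
... | inj₂ cycle = cycle
... | inj₁ u = contradiction (Fin.injective⇒≤ (Unique.lookup-injective u _ _)) 1+n≰n

-- Tight paths in the tournament of an acyclic set

edge-type : {W : Subset (length (permutations r))} {w : Vec (Fin n) r} (e : Edge (patternTournament r W) w) →
            SameOrder (values w) (values (perm r (proj₁ e)))
edge-type {r} (i , _ , v , v↑ , refl) = sameOrder-sym (increasing-map v↑ (perm-unique r i))

-- Both `tail p` and `init q` have the order type of the entries that the two windows share.
overlap⇒patternMatch : (w w′ : Vec (Fin n) (suc m)) (p q : Vec (Fin r) (suc m)) →
  SameOrder (values w) (values p) → SameOrder (values w′) (values q) →
  (∀ i → lookup w (suc i) ≡ lookup w′ (inject₁ i)) → PatternMatch (tail p) (init q)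
overlap⇒patternMatch (_ ∷ w) w′ (_ ∷ p) q w≈p w′≈q agree i j _ =
  sameOrder-trans (λ i j → sameOrder-sym w≈p (suc i) (suc j))
    (sameOrder-cong {x = values w′ ∘ inject₁} {y = values q ∘ inject₁}
      (λ i → cong toℕ (sym (agree i))) (λ i → cong toℕ (sym (lookup-init q i)))
      (λ i j → w′≈q (inject₁ i) (inject₁ j))) i j

patternTournament-paths : ∀ r .{{_ : NonZero r}} (W : Subset (length (permutations r))) → ¬ HasCycle (PSG r) W →
  Contains (patternTournament {n} r W) (tightPath r s) → s < length (permutations r) + r
patternTournament-paths {n} {s} (suc r) W acyclic (φ , _ , embeds) = ≰⇒> λ long →
  let open Windows long in acyclic (long-walk⇒cycle (PSG (suc r)) W type type∈ step)
  where
  Nᵣ = length (permutations (suc r))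
  module Windows (long : Nᵣ + suc r ≤ s) where
    -- The windows start at `0` to `Nᵣ`, one more than there are order types; the last of them ends
    -- at vertex `Nᵣ + r`, which is why `Nᵣ + suc r` vertices are enough.
    bound : (i : Fin (suc Nᵣ)) (j : Fin (suc r)) → toℕ i + toℕ j < s
    bound i j = <-≤-trans (+-mono-≤-< (s≤s⁻¹ (Fin.toℕ<n i)) (Fin.toℕ<n j)) long

    position : Fin (suc Nᵣ) → Fin (suc r) → Fin s
    position i j = fromℕ< (bound i j)

    start : (i : Fin (suc Nᵣ)) → toℕ i < suc s ∸ suc r
    start i = m+n≤o⇒m≤o∸n (suc (toℕ i)) (s≤s (≤-trans (+-monoˡ-≤ (suc r) (s≤s⁻¹ (Fin.toℕ<n i))) long))

    window : Fin (suc Nᵣ) → Vec (Fin n) (suc r)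
    window i = map φ (tabulate (position i))

    window-edge : ∀ i → Edge (patternTournament (suc r) W) (window i)
    window-edge i = embeds (fromℕ< (start i) , λ j →
      trans (cong toℕ (lookup∘tabulate (position i) j))
        (trans (Fin.toℕ-fromℕ< (bound i j)) (cong (_+ toℕ j) (sym (Fin.toℕ-fromℕ< (start i))))))

    type : Fin (suc Nᵣ) → Fin Nᵣ
    type i = proj₁ (window-edge i)

    type∈ : ∀ i → type i ∈ W
    type∈ i = proj₁ (proj₂ (window-edge i))

    window≈type : ∀ i → SameOrder (values (window i)) (values (perm (suc r) (type i)))
    window≈type i = edge-type (window-edge i)

    lookup-window : ∀ i j → lookup (window i) j ≡ φ (position i j)
    lookup-window i j = trans (lookup-map j φ (tabulate (position i))) (cong φ (lookup∘tabulate (position i) j))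

    step : ∀ i → PatternMatch (tail (perm (suc r) (type (inject₁ i)))) (init (perm (suc r) (type (suc i))))
    -- Entry `suc j` of window `i` and entry `j` of the next window are both the image of path
    -- vertex `i + j + 1`.
    step i = overlap⇒patternMatch (window (inject₁ i)) (window (suc i))
      (perm (suc r) (type (inject₁ i))) (perm (suc r) (type (suc i)))
      (window≈type (inject₁ i)) (window≈type (suc i)) λ j →
      trans (lookup-window (inject₁ i) (suc j)) (trans (cong φ (Fin.toℕ-injective
        (trans (Fin.toℕ-fromℕ< (bound (inject₁ i) (suc j)))
          (trans (trans (cong (_+ suc (toℕ j)) (Fin.toℕ-inject₁ i)) (trans (+-suc (toℕ i) (toℕ j))
              (cong (suc (toℕ i) +_) (sym (Fin.toℕ-inject₁ j)))))
            (sym (Fin.toℕ-fromℕ< (bound (suc i) (inject₁ j))))))))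
        (sym (lookup-window (suc i) (inject₁ j))))

-- Boundedness below the threshold

subset-of-size : (S : Subset n) → k ≤ ∣ S ∣ → ∃[ T ] ∣ T ∣ ≡ k × T ⊆ S
subset-of-size {n} {zero} S k≤ = ⊥ , ∣⊥∣≡0 n , λ x∈ → contradiction x∈ ∉⊥
subset-of-size {k = suc k} (inside ∷ S) k≤ with T , refl , T⊆S ← subset-of-size S (s≤s⁻¹ k≤) =
  inside ∷ T , refl , λ { Vec.here → Vec.here ; (Vec.there x∈) → Vec.there (T⊆S x∈) }
subset-of-size {k = suc k} (outside ∷ S) k≤ with T , eq , T⊆S ← subset-of-size S k≤ =
  outside ∷ T , eq , λ { (Vec.there x∈) → Vec.there (T⊆S x∈) }

-- Subsets of an acyclic set are acyclic, so one of size `k` gives an `(r , k)`-tournament for every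
-- `n`, and the bound on its tight paths does not depend on `n`.
acyclic⇒bounded : ∀ r .{{_ : NonZero r}} k → HasAcyclicSet (PSG r) s → k ≤ s → BoundedAtInfinity (λ n → f n r k)
acyclic⇒bounded r k (S , refl , acyclic) k≤ = bounded (subset-of-size S k≤)
  where
  bounded : ∃[ W ] ∣ W ∣ ≡ k × W ⊆ S → BoundedAtInfinity (λ n → f n r k)
  bounded (W , refl , W⊆S) = length (permutations r) + r , 0 , λ n _ →
    <⇒≤ (patternTournament-paths {n} r W
      (λ (m , c , c! , c∈ , lk) → acyclic (m , c , c! , All.map W⊆S c∈ , lk))
      (proj₁ (f-isMaximum (patternTournament r W) (patternTournament-isTournament W))
        (patternTournament r W) (patternTournament-isTournament W)))

f-bounded : ∀ r .{{_ : NonZero r}} k → k ≤ a (PSG r) → BoundedAtInfinity (λ n → f n r k)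
f-bounded r k = acyclic⇒bounded r k (proj₁ (a-isMaximum (PSG r)))

-- The threshold is at most `r !`

-- Dropping the first or the last entry of the identity leaves an increasing list. The loop keeps
-- the full vertex set from being acyclic.
identity-loop : ∀ r .{{_ : NonZero r}} → ∃[ i ] Digraph._⟶_ (PSG r) i i
identity-loop (suc r) = proj₁ identity-index , λ i j _ →
    subst (λ p → SameOrder (values (tail p)) (values (init p))) (sym (proj₂ identity-index)) self-match i j
  where
  identity-index : ∃[ i ] perm (suc r) i ≡ tabulate id
  identity-index = perm-index (Unique.tabulate⁺ id)

  self-match : SameOrder (values {n = suc r} (tail (tabulate id))) (values (init (tabulate id)))
  self-match = sameOrder-cong {x = suc ∘ toℕ} {y = toℕ}
    (λ i → cong toℕ (sym (lookup∘tabulate suc i)))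
    (λ i → trans (sym (Fin.toℕ-inject₁ i))
      (cong toℕ (sym (trans (lookup-init (tabulate id) i) (lookup∘tabulate id (inject₁ i))))))
    (λ _ _ → mk⇔ s<s⁻¹ s<s)

acyclic⇒small : ∀ r .{{_ : NonZero r}} → HasAcyclicSet (PSG r) s → s < length (permutations r)
acyclic⇒small r (S , refl , acyclic) = ≤∧≢⇒< (∣p∣≤n S) λ full →
  let i , loop = identity-loop r in
  acyclic (0 , i ∷ [] , [] ∷ [] , subst (i ∈_) (sym (∣p∣≡n⇒p≡⊤ full)) ∈⊤ ∷ [] , loop ∷ [-])

a<r! : ∀ r .{{_ : NonZero r}} → a (PSG r) < r !
a<r! r = <-≤-trans (acyclic⇒small r (proj₁ (a-isMaximum (PSG r)))) (∣permutations∣≤r! r)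

-- Ramsey's theorem

Homogeneous : (Vec A r → B) → List A → B → Set _
Homogeneous χ xs c = ∀ v → Vec.toList v ⊑ xs → χ v ≡ c

-- The colour of a tuple drawn from the list depends only on its first entry; `c` is the colour
-- attached to `x`.
data EndHomogeneous {A : Set ℓ} (χ : Vec A (suc r) → Bool) : List A → Set ℓ where
  []  : EndHomogeneous χ []
  _∷_ : ∀ {x xs} → ∃[ c ] Homogeneous (χ ∘ (x ∷_)) xs c → EndHomogeneous χ xs → EndHomogeneous χ (x ∷ xs)

homogeneous-[] : {χ : Vec A (suc r) → B} {c : B} → Homogeneous χ [] c
homogeneous-[] (_ ∷ _) ()

homogeneous-∷ : {χ : Vec A (suc r) → B} {c : B} {x : A} {xs ys : List A} →
  Homogeneous (χ ∘ (x ∷_)) xs c → ys ⊑ xs → Homogeneous χ ys c → Homogeneous χ (x ∷ ys) c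
homogeneous-∷ hom ys⊑xs hom′ v@(_ ∷ _) (_ ∷ʳ′ v⊑) = hom′ v v⊑
homogeneous-∷ hom ys⊑xs hom′ (_ ∷ v)   (refl ∷ v⊑) = hom v (Sublist.⊆-trans v⊑ ys⊑xs)

homogeneous-⊑ : {χ : Vec A r → B} {c : B} {xs ys : List A} → ys ⊑ xs → Homogeneous χ xs c → Homogeneous χ ys c
homogeneous-⊑ ys⊑xs hom v v⊑ = hom v (Sublist.⊆-trans v⊑ ys⊑xs)

HomogeneousSublist : (Vec A r → B) → List A → ℕ → B → Set _
HomogeneousSublist χ xs m c = ∃[ ys ] ys ⊑ xs × length ys ≡ m × Homogeneous χ ys c

-- Pigeonhole on the colours attached to the entries: those of one attached colour form a
-- homogeneous list, because every tuple takes the colour of its first entry.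
pick-colour : {χ : Vec A (suc r) → Bool} {xs : List A} → EndHomogeneous χ xs → ∀ s t → s + t ≤ length xs →
              HomogeneousSublist χ xs s true ⊎ HomogeneousSublist χ xs t false
pick-colour {xs = xs} _ zero    t       _ = inj₁ ([] , Sublist.minimum xs , refl , homogeneous-[])
pick-colour {xs = xs} _ (suc s) zero    _ = inj₂ ([] , Sublist.minimum xs , refl , homogeneous-[])
pick-colour ((true , hom) ∷ end) (suc s) (suc t) long with pick-colour end s (suc t) (s≤s⁻¹ long)
... | inj₁ (ys , ys⊑ , eq , hom′) = inj₁ (_ ∷ ys , refl ∷ ys⊑ , cong suc eq , homogeneous-∷ hom ys⊑ hom′)
... | inj₂ (ys , ys⊑ , eq , hom′) = inj₂ (ys , _ ∷ʳ′ ys⊑ , eq , hom′)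
pick-colour ((false , hom) ∷ end) (suc s) (suc t) long
  with pick-colour end (suc s) t (≤-trans (≤-reflexive (sym (+-suc s t))) (s≤s⁻¹ long))
... | inj₁ (ys , ys⊑ , eq , hom′) = inj₁ (ys , _ ∷ʳ′ ys⊑ , eq , hom′)
... | inj₂ (ys , ys⊑ , eq , hom′) = inj₂ (_ ∷ ys , refl ∷ ys⊑ , cong suc eq , homogeneous-∷ hom ys⊑ hom′)

-- The lengths that the induction below consumes: `m + m` entries let one of two colours occur `m`
-- times, and an end-homogeneous list spends one entry on its head before a Ramsey step for tuples
-- shorter by one.
ramseyNumber endHomogeneousNumber : ℕ → ℕ → ℕ
ramseyNumber zero    m = m
ramseyNumber (suc r) m = endHomogeneousNumber r (m + m)
endHomogeneousNumber r zero    = zero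
endHomogeneousNumber r (suc t) = suc (ramseyNumber r (endHomogeneousNumber r t))

length-take-≤ : (xs : List A) → m ≤ length xs → length (List.take m xs) ≡ m
length-take-≤ {m = m} xs m≤ = trans (List.length-take m xs) (m≤n⇒m⊓n≡m m≤)

-- Mutual induction with `end-homogeneous`: an end-homogeneous sublist is extracted first, then the
-- entries of one attached colour. For `r = 0` there is only the empty tuple, so any `m` entries
-- will do.
ramsey : ∀ r m (χ : Vec A r → Bool) (xs : List A) → ramseyNumber r m ≤ length xs →
         ∃[ c ] HomogeneousSublist χ xs m c
end-homogeneous : ∀ r t (χ : Vec A (suc r) → Bool) (xs : List A) → endHomogeneousNumber r t ≤ length xs →
                  ∃[ ys ] ys ⊑ xs × length ys ≡ t × EndHomogeneous χ ys
ramsey zero m χ xs long =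
  χ [] , List.take m xs , Sublist.take-⊆ m xs , length-take-≤ xs long , λ { [] _ → refl }
ramsey (suc r) m χ xs long with ys , ys⊑ , eq , end ← end-homogeneous r (m + m) χ xs long
  with pick-colour end m m (≤-reflexive (sym eq))
... | inj₁ (zs , zs⊑ , eq′ , hom) = true  , zs , Sublist.⊆-trans zs⊑ ys⊑ , eq′ , hom
... | inj₂ (zs , zs⊑ , eq′ , hom) = false , zs , Sublist.⊆-trans zs⊑ ys⊑ , eq′ , hom
end-homogeneous r zero    χ xs       _    = [] , Sublist.minimum xs , refl , []
end-homogeneous r (suc t) χ (x ∷ xs) long
  -- The tuples that start with `x` get a common colour on `ys`; the construction then continues
  -- inside `ys`, where that colour persists.
  with c , ys , ys⊑ , eq , hom ← ramsey r (endHomogeneousNumber r t) (χ ∘ (x ∷_)) xs (s≤s⁻¹ long)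
  with zs , zs⊑ , eq′ , end ← end-homogeneous r t χ ys (≤-reflexive (sym eq)) =
  x ∷ zs , refl ∷ Sublist.⊆-trans zs⊑ ys⊑ , cong suc eq′ , (c , homogeneous-⊑ zs⊑ hom) ∷ end

ramseyNumberᵛ : ℕ → ℕ → ℕ → ℕ
ramseyNumberᵛ zero    r m = m
ramseyNumberᵛ (suc N) r m = ramseyNumber r (ramseyNumberᵛ N r m)

-- One bit of the colour is made constant at a time, and passing to a sublist preserves the bits
-- already settled. A `Subset` is such a vector of bits, so `patternsAt` is an admissible colouring.
ramseyᵛ : ∀ N r m (χ : Vec A r → Vec Bool N) (xs : List A) → ramseyNumberᵛ N r m ≤ length xs →
          ∃[ c ] HomogeneousSublist χ xs m c
ramseyᵛ zero r m χ xs long =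
  [] , List.take m xs , Sublist.take-⊆ m xs , length-take-≤ xs long , λ v _ → []-unique (χ v)
  where
  []-unique : (v : Vec Bool 0) → v ≡ []
  []-unique [] = refl
ramseyᵛ (suc N) r m χ xs long
  with b , ys , ys⊑ , eq , hom ← ramsey r (ramseyNumberᵛ N r m) (head ∘ χ) xs long
  with c , zs , zs⊑ , eq′ , hom′ ← ramseyᵛ N r m (tail ∘ χ) ys (≤-reflexive (sym eq)) =
  b ∷ c , zs , Sublist.⊆-trans zs⊑ ys⊑ , eq′ , λ v v⊑ →
    head-tail (χ v) (hom v (Sublist.⊆-trans v⊑ zs⊑)) (hom′ v v⊑)
  where
  head-tail : ∀ {b c} (v : Vec Bool (suc N)) → head v ≡ b → tail v ≡ c → v ≡ b ∷ c
  head-tail (_ ∷ _) refl refl = refl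

-- Realising backward walks on a cycle by numbers

predecessor : {R : A → A → Set ℓ} {x y z : A} (v : Vec A m) → Linked R (x ∷ (v ∷ʳ z)) → y Vec.∈ (v ∷ʳ z) →
              ∃[ w ] w Vec.∈ (x ∷ v) × R w y
predecessor []      (xRz ∷ _) (VecAny.here refl) = _ , VecAny.here refl , xRz
predecessor (y ∷ v) (xRy ∷ _) (VecAny.here refl) = _ , VecAny.here refl , xRy
predecessor (_ ∷ v) (_ ∷ lk)  (VecAny.there y∈) with w , w∈ , wRy ← predecessor v lk y∈ =
  w , VecAny.there w∈ , wRy

-- Needed so that `predecessor` applies to every vertex of a cycle, including the one at which it is
-- cut open.
∈-rotate : {x y : A} (v : Vec A m) → y Vec.∈ (x ∷ v) → y Vec.∈ (v ∷ʳ x)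
∈-rotate []      (VecAny.here eq)               = VecAny.here eq
∈-rotate (_ ∷ v) (VecAny.here eq)               = VecAny.there (∈-rotate v (VecAny.here eq))
∈-rotate (_ ∷ v) (VecAny.there (VecAny.here eq)) = VecAny.here eq
∈-rotate (_ ∷ v) (VecAny.there (VecAny.there y∈)) = VecAny.there (∈-rotate v (VecAny.there y∈))

-- This locates the gap for a new entry: above all values that must lie below it, and no higher than
-- necessary. Without such values it is `0`.
strictSupremum : (x : Fin m → ℕ) {P : Pred (Fin m) ℓ} → Decidable P →
  ∃[ z ] (∀ i → P i → x i < z) × (∀ h → (∀ i → P i → x i < h) → z ≤ h)
strictSupremum {zero}  x P? = 0 , (λ ()) , λ _ _ → z≤n
strictSupremum {suc m} x P? with z , upper , least ← strictSupremum (x ∘ suc) (P? ∘ suc) with P? zero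
... | yes p = suc (x zero) ⊔ z ,
      (λ { zero _ → m≤m⊔n (suc (x zero)) z ; (suc i) q → ≤-trans (upper i q) (m≤n⊔m (suc (x zero)) z) }) ,
      λ h bound → ⊔-lub (bound zero p) (least h (bound ∘ suc))
... | no ¬p = z , (λ { zero p → contradiction p ¬p ; (suc i) → upper i }) , λ h bound → least h (bound ∘ suc)

-- `PatternMatch` compares positions `i < j` only; distinctness of the entries recovers the
-- comparison in the other order.
patternMatch⇒sameOrder : (v w : Vec (Fin n) m) → Injective _≡_ _≡_ (lookup v) → Injective _≡_ _≡_ (lookup w) →
                         PatternMatch v w → SameOrder (values v) (values w)
patternMatch⇒sameOrder v w v-inj w-inj match = sameOrder⁺ (v-inj ∘ Fin.toℕ-injective) mono
  where
  mono : ∀ i j → values v i < values v j → values w i < values w j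
  mono i j vᵢ<vⱼ with Fin.<-cmp i j
  ... | tri< i<j _ _ = to (match i j i<j) vᵢ<vⱼ
  ... | tri≈ _ refl _ = contradiction vᵢ<vⱼ (<-irrefl refl)
  ... | tri> _ i≢j j<i with <-cmp (values w i) (values w j)
  ...   | tri< wᵢ<wⱼ _ _ = wᵢ<wⱼ
  ...   | tri≈ _ eq _ = contradiction (w-inj (Fin.toℕ-injective eq)) i≢j
  ...   | tri> _ _ wⱼ<wᵢ = contradiction (from (match j i j<i) wⱼ<wᵢ) (<-asym vᵢ<vⱼ)

-- Each prepended entry doubles the range: old values x move to 2 x + 1, and the new value is even.
height : ℕ → ℕ → ℕ
height h zero    = h
height h (suc t) = suc (2 * height h t)

height-≥ : ∀ h t → h ≤ height h t
height-≥ h zero    = ≤-refl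
height-≥ h (suc t) = ≤-trans (height-≥ h t) (≤-trans (m≤m+n (height h t) _) (n≤1+n _))

-- The entries from index t + r on are junk.
record Realisation {r} (P : Pred (Fin (length (permutations r))) 0ℓ) (t : ℕ) : Set where
  field
    value    : ℕ → ℕ
    bounded  : ∀ i → value i < height r t
    distinct : ∀ i j → i < t + r → j < t + r → value i ≡ value j → i ≡ j
    windows  : ∀ i → i ≤ t → ∃[ p ] P p × SameOrder (λ j → value (i + toℕ j)) (values (perm r p))

open Realisation

-- The default `0` lies below every `suc n`, so the junk entries satisfy `bounded` as well.
padded : Vec (Fin n) m → ℕ → ℕ
padded []      _       = 0
padded (x ∷ v) zero    = toℕ x
padded (x ∷ v) (suc i) = padded v i

padded-lookup : (v : Vec (Fin n) m) (i : Fin m) → padded v (toℕ i) ≡ values v i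
padded-lookup (x ∷ v) zero    = refl
padded-lookup (x ∷ v) (suc i) = padded-lookup v i

padded-< : (v : Vec (Fin (suc n)) m) (i : ℕ) → padded v i < suc n
padded-< []      i       = z<s
padded-< (x ∷ v) zero    = Fin.toℕ<n x
padded-< (x ∷ v) (suc i) = padded-< v i

single-window : ∀ {P} p → P p → Realisation {suc r} P 0
single-window {r} p Pp = record
  { value    = padded π
  ; bounded  = padded-< π
  ; distinct = λ i j i< j< eq → trans (sym (Fin.toℕ-fromℕ< i<)) (trans
      (cong toℕ (values-injective (perm-unique (suc r) p)
        (trans (sym (at i<)) (trans eq (at j<)))))
      (Fin.toℕ-fromℕ< j<))
  ; windows  = λ { zero _ → p , Pp ,
      sameOrder-cong {x = values π} {y = values π}
        (λ i → sym (padded-lookup π i)) (λ _ → refl) (λ _ _ → mk⇔ id id) }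
  }
  where
  π = perm (suc r) p

  at : ∀ {i} (i< : i < suc r) → padded π i ≡ values π (fromℕ< i<)
  at {i} i< = trans (cong (padded π) (sym (Fin.toℕ-fromℕ< i<))) (padded-lookup π (fromℕ< i<))

consˢ : A → (ℕ → A) → ℕ → A
consˢ y x zero    = y
consˢ y x (suc i) = x i

sameOrder-odd : (x : Fin m → ℕ) → SameOrder (λ i → suc (2 * x i)) x
sameOrder-odd x i j = mk⇔ (*-cancelˡ-< 2 (x i) (x j) ∘ s<s⁻¹) (s<s ∘ *-monoʳ-< 2)

-- Since `tail p` matches `init q`, the old values already have the order type of `tail p`, and only
-- the rank of the new entry is at stake. Old values become odd and the new one is `2 * z`, with `z`
-- the least strict upper bound of those that `p` puts below its head. The bound on `z` keeps the
-- new entry within `height`.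
extend-window : ∀ (p q : Vec (Fin n) (suc m)) → Unique p → Unique q → PatternMatch (tail p) (init q) →
  (x : ℕ → ℕ) → SameOrder (x ∘ toℕ) (values q) →
  ∃[ z ] (∀ h → (∀ i → x i < h) → z ≤ h) ×
    SameOrder (consˢ (2 * z) (λ i → suc (2 * x i)) ∘ toℕ) (values p)
extend-window {m = m} p@(p₀ ∷ p′) q p!@(_ ∷ p′!) q! match x x≈q =
  z , (λ h bound → least h λ i _ → bound (toℕ i)) , sameOrder-sym (sameOrder⁺ (values-injective p!) mono)
  where
  supremum = strictSupremum (x ∘ toℕ) (λ i → lookup p′ i Fin.<? p₀)
  z     = proj₁ supremum
  upper = proj₁ (proj₂ supremum)
  least = proj₂ (proj₂ supremum)

  init-injective : Injective _≡_ _≡_ (lookup (init q))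
  init-injective {i} {j} eq = Fin.inject₁-injective (Unique.lookup-injective q! _ _
    (trans (sym (lookup-init q i)) (trans eq (lookup-init q j))))

  p′≈x : SameOrder (values p′) (x ∘ toℕ)
  p′≈x = sameOrder-trans
    (patternMatch⇒sameOrder p′ (init q) (Unique.lookup-injective p′! _ _) init-injective match)
    (sameOrder-cong {x = values q ∘ inject₁} {y = x ∘ toℕ ∘ inject₁}
      (λ i → cong toℕ (sym (lookup-init q i))) (λ i → cong x (Fin.toℕ-inject₁ i))
      (λ i j → sameOrder-sym x≈q (inject₁ i) (inject₁ j)))

  mono : ∀ i j → values p i < values p j →
         consˢ (2 * z) (λ i → suc (2 * x i)) (toℕ i) < consˢ (2 * z) (λ i → suc (2 * x i)) (toℕ j)
  mono zero    zero    p< = contradiction p< (<-irrefl refl)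
  -- All values that must lie below the new entry are less than `x j`, so `z ≤ x j` and `2 * z` is
  -- below `2 * x j + 1`.
  mono zero    (suc j) p< = s≤s (*-monoʳ-≤ 2 (least _ λ i pᵢ< → to (p′≈x i j) (<-trans pᵢ< p<)))
  -- Here `x i < z`, so `2 * x i + 1` is below `2 * z`.
  mono (suc i) zero    p< = ≤-trans (≤-reflexive (cong suc (sym (+-suc (x (toℕ i)) _))))
                           (*-monoʳ-≤ 2 (upper i p<))
  mono (suc i) (suc j) p< = from (sameOrder-odd (x ∘ toℕ) i j) (to (p′≈x i j) p<)

-- A predecessor of the type of the first window prescribes the order type of the new first window.
-- The remaining windows keep theirs, since doubling and adding one is strictly increasing.
extend : ∀ {P t} → (∀ q → P q → ∃[ p ] P p × Digraph._⟶_ (PSG (suc r)) p q) →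
         Realisation {suc r} P t → Realisation {suc r} P (suc t)
extend {r} {P} {t} pred R with q , Pq , x≈q ← windows R 0 z≤n with p , Pp , p⟶q ← pred q Pq
  with z , z≤ , x′≈p ← extend-window (perm (suc r) p) (perm (suc r) q)
                         (perm-unique (suc r) p) (perm-unique (suc r) q)
                         p⟶q (value R) x≈q = record
  { value    = consˢ (2 * z) λ i → suc (2 * value R i)
  ; bounded  = λ { zero    → s≤s (*-monoʳ-≤ 2 (z≤ _ (bounded R)))
                 ; (suc i) → s<s (*-monoʳ-< 2 (bounded R i)) }
  ; distinct = λ { zero    zero    _  _  _  → refl
                 ; zero    (suc j) _  _  eq → contradiction eq (even≢odd z (value R j))
                 ; (suc i) zero    _  _  eq → contradiction (sym eq) (even≢odd z (value R i))
                 ; (suc i) (suc j) i< j< eq → cong suc (distinct R i j (s<s⁻¹ i<) (s<s⁻¹ j<)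
                     (*-cancelˡ-≡ _ _ 2 (suc-injective eq))) }
  ; windows  = λ { zero    _  → p , Pp , x′≈p
                 ; (suc i) i≤ → let p , Pp , x≈p = windows R i (s≤s⁻¹ i≤) in
                     p , Pp , sameOrder-trans (sameOrder-odd λ j → value R (i + toℕ j)) x≈p }
  }

realise : ∀ {P} p → P p → (∀ q → P q → ∃[ p ] P p × Digraph._⟶_ (PSG (suc r)) p q) →
          ∀ t → Realisation {suc r} P t
realise p Pp pred zero    = single-window p Pp
realise p Pp pred (suc t) = extend pred (realise p Pp pred t)

-- Sorted vectors and sublists

range : Vec (Fin n) m → Subset n
range []      = ⊥
range (x ∷ v) = ⁅ x ⁆ ∪ range v

lookup∈range : (v : Vec (Fin n) m) (i : Fin m) → lookup v i ∈ range v
lookup∈range (x ∷ v) zero    = x∈p∪q⁺ (inj₁ (x∈⁅x⁆ x))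
lookup∈range (x ∷ v) (suc i) = x∈p∪q⁺ (inj₂ (lookup∈range v i))

∈range⇒lookup : (v : Vec (Fin n) m) → ∀ {x} → x ∈ range v → ∃[ i ] lookup v i ≡ x
∈range⇒lookup []      x∈ = contradiction x∈ ∉⊥
∈range⇒lookup (y ∷ v) x∈ with x∈p∪q⁻ ⁅ y ⁆ (range v) x∈
... | inj₁ x∈⁅y⁆ = zero , sym (x∈⁅y⁆⇒x≡y y x∈⁅y⁆)
... | inj₂ x∈v with i , eq ← ∈range⇒lookup v x∈v = suc i , eq

∣⁅x⁆∪p∣ : (x : Fin n) (p : Subset n) → x ∉ p → ∣ ⁅ x ⁆ ∪ p ∣ ≡ suc ∣ p ∣
∣⁅x⁆∪p∣ zero    (inside ∷ p)  x∉ = contradiction Vec.here x∉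
∣⁅x⁆∪p∣ zero    (outside ∷ p) x∉ = cong (suc ∘ ∣_∣) (∪-identityˡ p)
∣⁅x⁆∪p∣ (suc x) (inside ∷ p)  x∉ = cong suc (∣⁅x⁆∪p∣ x p (x∉ ∘ Vec.there))
∣⁅x⁆∪p∣ (suc x) (outside ∷ p) x∉ = ∣⁅x⁆∪p∣ x p (x∉ ∘ Vec.there)

∣range∣ : {v : Vec (Fin n) m} → Unique v → ∣ range v ∣ ≡ m
∣range∣ {n}         []       = ∣⊥∣≡0 n
∣range∣ {v = x ∷ v} (x∉ ∷ u) = trans
  (∣⁅x⁆∪p∣ x (range v) λ x∈ → let i , eq = ∈range⇒lookup v x∈ in All.lookup⁺ x∉ i (sym eq))
  (cong suc (∣range∣ u))

AllPairs-lookup⁻ : {R : A → A → Set ℓ} {v : Vec A n} → (∀ {i j} → i Fin.< j → R (lookup v i) (lookup v j)) →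
                   AllPairs R v
AllPairs-lookup⁻ {v = []}    _   = []
AllPairs-lookup⁻ {v = _ ∷ _} rel = All.lookup⁻ (λ i → rel {zero} {suc i} z<s) ∷ AllPairs-lookup⁻ (rel ∘ s<s)

-- Composing `u` with the inverse of `p` sorts it. The last component records that sorting
-- introduces no new entries.
increasing-arrangement : (p : Vec (Fin r) r) (u : Vec (Fin n) r) → Unique p → SameOrder (values p) (values u) →
  ∃[ v ] Increasing v × map (lookup v) p ≡ u × (∀ {P : Pred (Fin n) 0ℓ} → All P u → All P v)
increasing-arrangement {r} {n} p u p! p≈u = v , AllPairs-lookup⁻ ordered , vec-ext arranged , λ all →
  All.tabulate⁺ λ i → All.lookup⁺ all (inverse i)
  where
  preimage : ∀ i → ∃[ j ] lookup p j ≡ i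
  preimage = injective⇒surjective (Unique.lookup-injective p! _ _)

  inverse : Fin r → Fin r
  inverse = proj₁ ∘ preimage

  v : Vec (Fin n) r
  v = tabulate (lookup u ∘ inverse)

  ordered : ∀ {i j} → i Fin.< j → lookup v i Fin.< lookup v j
  ordered {i} {j} i<j = subst₂ Fin._<_ (sym (lookup∘tabulate _ i)) (sym (lookup∘tabulate _ j))
    (to (p≈u (inverse i) (inverse j))
      (subst₂ Fin._<_ (sym (proj₂ (preimage i))) (sym (proj₂ (preimage j))) i<j))

  arranged : ∀ i → lookup (map (lookup v) p) i ≡ lookup u i
  arranged i = trans (lookup-map i (lookup v) p) (trans (lookup∘tabulate _ (lookup p i))
    (cong (lookup u) (Unique.lookup-injective p! _ _ (proj₂ (preimage (lookup p i))))))

-- Homogeneity speaks of sublists; between increasing sequences, membership of the entries suffices.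
-- If `x` is not the head `y`, then `y` lies below all of `x ∷ v` and can be skipped.
increasing⇒⊑ : (v : Vec (Fin n) m) (ys : List (Fin n)) → Increasing v → ListAllPairs.AllPairs Fin._<_ ys →
               All (List._∈ ys) v → Vec.toList v ⊑ ys
increasing⇒⊑ []      ys       _           _           _                 = Sublist.minimum ys
increasing⇒⊑ (x ∷ v) (y ∷ ys) (x< ∷ v↑)   (y< ∷ ys↑)  (x∈ ∷ v∈) = helper x∈
  where
  above : ∀ {m} {w : Vec (Fin _) m} → All (y Fin.<_) w → All (List._∈ (y ∷ ys)) w → All (List._∈ ys) w
  above []       []                = []
  above (y< ∷ _) (here refl ∷ _)   = contradiction y< (<-irrefl refl)
  above (_ ∷ ps) (there x∈  ∷ qs)  = x∈ ∷ above ps qs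

  helper : x List.∈ (y ∷ ys) → x ∷ Vec.toList v ⊑ (y ∷ ys)
  helper (here refl) = refl ∷ increasing⇒⊑ v ys v↑ ys↑ (above x< v∈)
  helper (there x∈′) = y ∷ʳ′ increasing⇒⊑ (x ∷ v) ys (x< ∷ v↑) ys↑
    (x∈′ ∷ above (All.map (<-trans (ListAll.lookup y< x∈′)) x<) v∈)

⊑-increasing : {xs ys : List (Fin n)} → ys ⊑ xs → ListAllPairs.AllPairs Fin._<_ xs →
               ListAllPairs.AllPairs Fin._<_ ys
⊑-increasing []          []       = []
⊑-increasing (_ ∷ʳ′ ys⊑) (_ ∷ ↑)  = ⊑-increasing ys⊑ ↑
⊑-increasing (refl ∷ ys⊑) (x< ∷ ↑) = Sublist.All-resp-⊆ ys⊑ x< ∷ ⊑-increasing ys⊑ ↑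

toList-increasing⁻ : (v : Vec (Fin n) m) → ListAllPairs.AllPairs Fin._<_ (Vec.toList v) → Increasing v
toList-increasing⁻ []      []      = []
toList-increasing⁻ (x ∷ v) (x< ∷ ↑) = All.toList⁻ x< ∷ toList-increasing⁻ v ↑

prefix : ∀ m (xs : List A) → m ≤ length xs → ∃[ v ] Vec.toList {n = m} v ⊑ xs
prefix zero    xs       _  = [] , Sublist.minimum xs
prefix (suc m) (x ∷ xs) m≤ with v , v⊑ ← prefix m xs (s≤s⁻¹ m≤) = x ∷ v , refl ∷ v⊑

lookup-mono-< : {xs : List (Fin n)} → ListAllPairs.AllPairs Fin._<_ xs →
                ∀ {i j} → i Fin.< j → List.lookup xs i Fin.< List.lookup xs j
lookup-mono-< (x< ∷ _) {zero}  {suc j} _   = ListAll.lookup x< (List.∈-lookup j)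
lookup-mono-< (_ ∷ ↑) {suc i} {suc j} i<j = lookup-mono-< ↑ (s<s⁻¹ i<j)

-- Tight paths in a homogeneous set

module _ (G : RDigraph r n) {W : Subset (length (permutations r))} {ys : List (Fin n)}
         (ys↑ : ListAllPairs.AllPairs Fin._<_ ys) (homogeneous : Homogeneous (patternsAt (edge? G)) ys W) where

  -- Any `r` entries of `ys` form an `r`-set: the tournament has `k` edges on it, and their order
  -- types make up `W`.
  homogeneous-size : IsTournament k G → r ≤ length ys → ∣ W ∣ ≡ k
  homogeneous-size tour r≤ with v , v⊑ ← prefix r ys r≤ =
    trans (cong ∣_∣ (sym (homogeneous v v⊑)))
      (trans (sym (length-orderings (edge? G) (range v) v v! (lookup∈range v) (∈range⇒lookup v)))
        (tour (range v) (∣range∣ v!)))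
    where
    v! : Unique v
    v! = increasing⇒unique (toList-increasing⁻ v (⊑-increasing v⊑ ys↑))

  -- Sorting `u` gives an increasing tuple from `ys`, whose accepted order types are exactly `W`.
  homogeneous-edge : ∀ p → p ∈ W → (u : Vec (Fin n) r) → All (List._∈ ys) u →
                     SameOrder (values u) (values (perm r p)) →
                     Edge G u
  homogeneous-edge p p∈ u u∈ u≈p
    with v , v↑ , refl , sub ← increasing-arrangement (perm r p) u (perm-unique r p) (sameOrder-sym u≈p) =
    ∈-tabulate⁻ (λ i → edge? G (map (lookup v) (perm r i)))
      (subst (p ∈_) (sym (homogeneous v (increasing⇒⊑ v ys v↑ ys↑ (sub u∈)))) p∈)

  -- The numbers of the realisation serve as positions in `ys`, which `height` keeps in range. As
  -- `ys` is increasing, the chosen vertices have the same order types as the numbers.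
  homogeneous-path : ∀ {t} {P : Pred (Fin (length (permutations r))) 0ℓ} → (∀ {p} → P p → p ∈ W) →
                     height r t ≤ length ys → Realisation {r} P t → Contains G (tightPath r (t + r))
  homogeneous-path {t} P⊆W long R = φ , φ-injective , λ { {e} (i , consecutive) → path-edge i e consecutive }
    where
    bound : ∀ i → value R i < length ys
    bound i = <-≤-trans (bounded R i) long

    place : ℕ → Fin n
    place i = List.lookup ys (fromℕ< (bound i))

    φ : Fin (t + r) → Fin n
    φ = place ∘ toℕ

    φ-injective : Injective _≡_ _≡_ φ
    φ-injective {i} {j} eq = Fin.toℕ-injective (distinct R (toℕ i) (toℕ j) (Fin.toℕ<n i) (Fin.toℕ<n j)
      (Fin.fromℕ<-injective _ _ (bound (toℕ i)) (bound (toℕ j))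
        (list-lookup-injective (ListAllPairs.map Fin.<⇒≢ ys↑) _ _ eq)))

    place-mono : ∀ i j → value R i < value R j → place i Fin.< place j
    place-mono i j x< = lookup-mono-< ys↑
      (subst₂ _<_ (sym (Fin.toℕ-fromℕ< (bound i))) (sym (Fin.toℕ-fromℕ< (bound j))) x<)

    path-edge : (i : Fin (suc (t + r) ∸ r)) (e : Vec (Fin (t + r)) r) →
                (∀ j → toℕ (lookup e j) ≡ toℕ i + toℕ j) → Edge G (map φ e)
    -- There are `suc (t + r) ∸ r = suc t` edges, so `i ≤ t` and `windows` covers position `i`.
    path-edge i e consecutive with p , Pp , x≈p ← windows R (toℕ i)
      (s≤s⁻¹ (subst (toℕ i <_) (m+n∸n≡m (suc t) r) (Fin.toℕ<n i))) =
      homogeneous-edge p (P⊆W Pp) (map φ e)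
        (All.map⁺ (All.lookup⁻ λ j → List.∈-lookup (fromℕ< (bound (toℕ (lookup e j))))))
        (sameOrder-sym (sameOrder⁺ (values-injective (perm-unique r p)) λ j k p< →
          subst₂ Fin._<_ (sym (located j)) (sym (located k))
            (place-mono (toℕ i + toℕ j) (toℕ i + toℕ k) (from (x≈p j k) p<))))
      where
      located : ∀ j → lookup (map φ e) j ≡ place (toℕ i + toℕ j)
      located j = trans (lookup-map j φ e) (cong place (consecutive j))

cycle⇒realisation : ∀ r .{{_ : NonZero r}} {W} → HasCycle (PSG r) W → ∀ t → Realisation {r} (_∈ W) t
cycle⇒realisation (suc r) {W} (m , x ∷ c , _ , c⊆W , lk) t = record
  { value    = value R
  ; bounded  = bounded R
  ; distinct = distinct R
  ; windows  = λ i i≤ → let p , p∈ , x≈p = windows R i i≤ in p , c⊆W′ p∈ , x≈p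
  }
  where
  -- The predicate is membership in the cycle rather than in `W`: every vertex of the cycle has a
  -- predecessor on the cycle, whereas a vertex of `W` may have none in `W`.
  R : Realisation {suc r} (Vec._∈ (x ∷ c)) t
  R = realise x (VecAny.here refl) (λ q q∈ → predecessor c lk (∈-rotate c q∈)) t

  c⊆W′ : ∀ {p} → p Vec.∈ (x ∷ c) → p ∈ W
  c⊆W′ = All.lookup c⊆W

-- Unboundedness above the threshold

greatest-≥ : {P : Pred ℕ ℓ} (P? : Decidable P) → ∀ b {s} → P s → s ≤ b → s ≤ greatest P? b
greatest-≥ P? zero    Ps s≤b = s≤b
greatest-≥ P? (suc b) Ps s≤b with P? (suc b)
... | yes _ = s≤b
... | no ¬p = greatest-≥ P? b Ps (s≤s⁻¹ (≤∧≢⇒< s≤b λ { refl → ¬p Ps }))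

large⇒cycle : (G : Digraph N) (W : Subset N) → a G < ∣ W ∣ → HasCycle G W
large⇒cycle G W large = decidable-stable (hasCycle? G W) λ acyclic →
  <⇒≱ large (proj₂ (a-isMaximum G) ∣ W ∣ (W , refl , acyclic))

forced-path : ∀ r .{{_ : NonZero r}} t → a (PSG r) < k →
  ramseyNumberᵛ (length (permutations r)) r (height r t) ≤ n → Forced n r k (t + r)
forced-path {k} {n} r t a<k large G tour = from-homogeneous (ramseyᵛ (length (permutations r)) r
    (height r t) (patternsAt (edge? G)) (allFin n)
    (≤-trans large (≤-reflexive (sym (List.length-tabulate id)))))
  where
  from-homogeneous : ∃[ W ] HomogeneousSublist (patternsAt (edge? G)) (allFin n) (height r t) W →
                     Contains G (tightPath r (t + r))
  from-homogeneous (W , ys , ys⊑ , eq , hom) = homogeneous-path G ys↑ hom id (≤-reflexive (sym eq))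
      (cycle⇒realisation r (large⇒cycle (PSG r) W (<-≤-trans a<k (≤-reflexive (sym ∣W∣≡k)))) t)
    where
    ys↑ : ListAllPairs.AllPairs Fin._<_ ys
    ys↑ = ⊑-increasing ys⊑ (ListAllPairs.tabulate⁺-< id)

    ∣W∣≡k : ∣ W ∣ ≡ k
    -- Since `height r t` is at least `r`, the homogeneous list contains an `r`-set on which to
    -- count edges.
    ∣W∣≡k = homogeneous-size G ys↑ hom tour (≤-trans (height-≥ r t) (≤-reflexive (sym eq)))

forced⇒unbounded : (∀ t → ∃[ n₀ ] ∀ n → n₀ ≤ n → Forced n r k (t + r)) → TendsToInfinity (λ n → f n r k)
-- Adding `t + r` ensures `t + r ≤ n`, because `f` searches only up to `n`.
forced⇒unbounded {r} {k} forced t = n₀ + (t + r) , λ n n≥ → ≤-trans (m≤m+n t r)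
    (greatest-≥ (forced? n r k) n (proj₂ (forced t) n (≤-trans (m≤m+n n₀ (t + r)) n≥))
      (≤-trans (m≤n+m (t + r) n₀) n≥))
  where
  n₀ : ℕ
  n₀ = proj₁ (forced t)

f-unbounded : ∀ r .{{_ : NonZero r}} k → a (PSG r) < k → TendsToInfinity (λ n → f n r k)
f-unbounded r k a<k = forced⇒unbounded λ t →
  ramseyNumberᵛ (length (permutations r)) r (height r t) , λ n → forced-path r t a<k

bounded⇒¬unbounded : ∀ g → BoundedAtInfinity g → ¬ TendsToInfinity g
bounded⇒¬unbounded g (C , n₀ , bounded) diverges = 1+n≰n (≤-trans
  (proj₂ (diverges (suc C)) (n₀ + n₁) (m≤n+m n₁ n₀)) (bounded (n₀ + n₁) (m≤m+n n₀ n₁)))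
  where
  n₁ : ℕ
  n₁ = proj₁ (diverges (suc C))

theorem7 : (r : ℕ) .{{_ : NonZero r}} →
    IsThreshold r (1 + a (PSG r)) ×
    (∀ k → k ≤ r ! →
    (k ≤ a (PSG r) → BoundedAtInfinity (λ n → f n r k)) ×
    (a (PSG r) < k → TendsToInfinity (λ n → f n r k)))
theorem7 r =
  ( (a<r! r , f-unbounded r (suc (a (PSG r))) (n<1+n (a (PSG r))))
  -- Minimality: for `k ≤ a (PSG r)` the function is bounded and cannot tend to infinity.
  , λ k _ unbounded → ≰⇒> λ k≤a → bounded⇒¬unbounded (λ n → f n r k) (f-bounded r k k≤a) unbounded)
  , λ k _ → f-bounded r k , f-unbounded r k
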